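{- Let $\tau \geq 1$ be a real number, and let $\mathcal{S}$ be a finite set of integers of the form $\lfloor \tau k \rfloor$ with $k \in \mathbb{N}$. Let $x$ and $y$ be two distinct elements of $\mathcal{S}$. Then $\tau < 1 + |x-y|$.
   Context: $\mathbb{N} = \{0,1,2,\dots\}$. The set $\mathcal{S}$ represents the set of distinct values observed in a finite sample of $X = \lfloor \tau N \rfloor$, with $N$ an $\mathbb{N}$-valued random variable. -}

module Defs where

open import Algebra.Bundles using (CommutativeMonoid)
open import Data.Integer.Base as ℤ using (ℤ)
open import Data.Nat.Base as ℕ using (ℕ)
import Data.Nat.Properties as ℕₚ
open import Data.Product using (∃-syntax; _×_; _,_)
open import Data.Rational.Base
open import Data.Rational.Properties
open import Relation.Binary.PropositionalEquality
  using (_≡_; sym; trans; cong; cong₂; subst)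
open import Algebra.Properties.CommutativeSemigroup
  (CommutativeMonoid.commutativeSemigroup +-0-commutativeMonoid) using (interchange)
open import Algebra.Properties.Ring +-*-ring using (x[y-z]≈xy-xz; [y-z]x≈yx-zx)

IsCauchy : (ℕ → ℚ) → Set
IsCauchy s = ∀ ε → 0ℚ < ε →
  ∃[ N ] (∀ m n → N ℕ.≤ m → N ℕ.≤ n → ∣ s m - s n ∣ < ε)

-- The real numbers as Cauchy sequences of rationals.  Their equality is
-- "x ≤ℝ y and y ≤ℝ x", not _≡_.
record ℝ : Set where
  constructor mkℝ
  field
    seq    : ℕ → ℚ
    cauchy : IsCauchy seq

open ℝ public

private
  split : ∀ a b → (a - b) + b ≡ a
  split a b = trans (+-assoc a (- b) b)
    (trans (cong (a +_) (+-inverseˡ b)) (+-identityʳ a))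

  split-+ : ∀ a b c d → (a - b) + (c - d) ≡ (a + c) - (b + d)
  split-+ a b c d = trans (interchange a (- b) c (- d))
    (cong ((a + c) +_) (sym (neg-distrib-+ b d)))

  split-* : ∀ a b c d → a * (c - d) + d * (a - b) ≡ a * c - b * d
  split-* a b c d = trans
    (cong₂ _+_ (x[y-z]≈xy-xz a c d) (trans (*-comm d (a - b)) ([y-z]x≈yx-zx d a b)))
    (trans (sym (+-assoc (a * c - a * d) (a * d) (- (b * d))))
      (cong (_- b * d) (split (a * c) (a * d))))

  half-sum : ∀ ε → ½ * ε + ½ * ε ≡ ε
  half-sum ε = trans (sym (*-distribʳ-+ ε ½ ½)) (*-identityˡ ε)

  half-pos : ∀ {ε} → 0ℚ < ε → 0ℚ < ½ * ε
  half-pos {ε} 0<ε = subst (_< ½ * ε) (*-zeroʳ ½) (*-monoʳ-<-pos ½ 0<ε)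

  eventually-bounded : ∀ {s} → IsCauchy s →
    ∃[ N ] ∃[ A ] (Positive A × (∀ n → N ℕ.≤ n → ∣ s n ∣ ≤ A))
  eventually-bounded {s} c with c 1ℚ (positive⁻¹ 1ℚ)
  ... | N , close = N , 1ℚ + ∣ s N ∣ ,
      pos+nonNeg⇒pos 1ℚ ∣ s N ∣ {{∣-∣-nonNeg (s N)}} , λ n N≤n →
      ≤-trans
        (subst (λ q → ∣ q ∣ ≤ ∣ s n - s N ∣ + ∣ s N ∣)
          (split (s n) (s N))
          (∣p+q∣≤∣p∣+∣q∣ (s n - s N) (s N)))
        (+-monoˡ-≤ ∣ s N ∣ (<⇒≤ (close n N N≤n ℕₚ.≤-refl)))

  scale : ∀ {p A d δ} → Positive A → ∣ p ∣ ≤ A → ∣ d ∣ < δ → ∣ p * d ∣ < A * δ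
  scale {p} {A} {d} {δ} posA p≤A d<δ = subst (_< A * δ) (sym (∣p*q∣≡∣p∣*∣q∣ p d))
    (≤-<-trans (*-monoʳ-≤-nonNeg ∣ d ∣ {{∣-∣-nonNeg d}} p≤A)
               (*-monoʳ-<-pos A {{posA}} d<δ))

const-cauchy : ∀ q → IsCauchy (λ _ → q)
const-cauchy q ε 0<ε = 0 , λ _ _ _ _ →
  subst (λ d → ∣ d ∣ < ε) (sym (+-inverseʳ q)) 0<ε

+-cauchy : ∀ {s t} → IsCauchy s → IsCauchy t → IsCauchy (λ n → s n + t n)
+-cauchy {s} {t} cs ct ε 0<ε
  with cs (½ * ε) (half-pos 0<ε) | ct (½ * ε) (half-pos 0<ε)
... | M , f | N , g = M ℕ.⊔ N , λ m n p q →
  subst (∣ (s m + t m) - (s n + t n) ∣ <_) (half-sum ε)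
  (≤-<-trans
    (subst (λ d → ∣ d ∣ ≤ ∣ s m - s n ∣ + ∣ t m - t n ∣)
      (split-+ (s m) (s n) (t m) (t n))
      (∣p+q∣≤∣p∣+∣q∣ (s m - s n) (t m - t n)))
    (+-mono-<
      (f m n (ℕₚ.m⊔n≤o⇒m≤o M N p) (ℕₚ.m⊔n≤o⇒m≤o M N q))
      (g m n (ℕₚ.m⊔n≤o⇒n≤o M N p) (ℕₚ.m⊔n≤o⇒n≤o M N q))))

*-cauchy : ∀ {s t} → IsCauchy s → IsCauchy t → IsCauchy (λ n → s n * t n)
*-cauchy {s} {t} cs ct ε 0<ε with eventually-bounded cs | eventually-bounded ct
... | M , A , posA , s≤A | N , B , posB , t≤B = go
  where
  K : ℚ
  K = A + B
  instance
    posK : Positive K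
    posK = pos+pos⇒pos A {{posA}} B {{posB}}
    nzK : NonZero K
    nzK = pos⇒nonZero K
  δ : ℚ
  δ = 1/ K * ε
  0<δ : 0ℚ < δ
  0<δ = subst (_< δ) (*-zeroʳ (1/ K)) (*-monoʳ-<-pos (1/ K) {{1/pos⇒pos K}} 0<ε)
  Kδ≡ε : A * δ + B * δ ≡ ε
  Kδ≡ε = trans (sym (*-distribʳ-+ δ A B)) (trans (sym (*-assoc K (1/ K) ε))
    (trans (cong (_* ε) (*-inverseʳ K)) (*-identityˡ ε)))
  go : ∃[ L ] (∀ m n → L ℕ.≤ m → L ℕ.≤ n → ∣ s m * t m - s n * t n ∣ < ε)
  go with cs δ 0<δ | ct δ 0<δ
  ... | P , f | Q , g = (M ℕ.⊔ N) ℕ.⊔ (P ℕ.⊔ Q) , λ m n p q →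
    let pˡ = ℕₚ.m⊔n≤o⇒m≤o (M ℕ.⊔ N) (P ℕ.⊔ Q) p
        qˡ = ℕₚ.m⊔n≤o⇒m≤o (M ℕ.⊔ N) (P ℕ.⊔ Q) q
        pʳ = ℕₚ.m⊔n≤o⇒n≤o (M ℕ.⊔ N) (P ℕ.⊔ Q) p
        qʳ = ℕₚ.m⊔n≤o⇒n≤o (M ℕ.⊔ N) (P ℕ.⊔ Q) q
    in subst (∣ s m * t m - s n * t n ∣ <_) Kδ≡ε
      (≤-<-trans
        (subst (λ d → ∣ d ∣ ≤ ∣ s m * (t m - t n) ∣ + ∣ t n * (s m - s n) ∣)
          (split-* (s m) (s n) (t m) (t n))
          (∣p+q∣≤∣p∣+∣q∣ (s m * (t m - t n)) (t n * (s m - s n))))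
        (+-mono-<
          (scale {s m} posA (s≤A m (ℕₚ.m⊔n≤o⇒m≤o M N pˡ))
            (g m n (ℕₚ.m⊔n≤o⇒n≤o P Q pʳ) (ℕₚ.m⊔n≤o⇒n≤o P Q qʳ)))
          (scale {t n} posB (t≤B n (ℕₚ.m⊔n≤o⇒n≤o M N qˡ))
            (f m n (ℕₚ.m⊔n≤o⇒m≤o P Q pʳ) (ℕₚ.m⊔n≤o⇒m≤o P Q qʳ)))))

infixl 6 _+ℝ_
infixl 7 _*ℝ_
infix  4 _<ℝ_ _≤ℝ_

_+ℝ_ : ℝ → ℝ → ℝ
x +ℝ y = mkℝ (λ n → seq x n + seq y n)
             (+-cauchy {seq x} {seq y} (cauchy x) (cauchy y))

_*ℝ_ : ℝ → ℝ → ℝ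
x *ℝ y = mkℝ (λ n → seq x n * seq y n)
             (*-cauchy {seq x} {seq y} (cauchy x) (cauchy y))

fromℚ : ℚ → ℝ
fromℚ q = mkℝ (λ _ → q) (const-cauchy q)

fromℤ : ℤ → ℝ
fromℤ i = fromℚ (i / 1)

fromℕ : ℕ → ℝ
fromℕ k = fromℤ (ℤ.+ k)

1ℝ : ℝ
1ℝ = fromℚ 1ℚ

-- A termwise comparison would depend on the representing sequence: the strict
-- order needs a uniform positive gap, the weak order allows a vanishing error.
_<ℝ_ : ℝ → ℝ → Set
x <ℝ y = ∃[ ε ] (0ℚ < ε × ∃[ N ] (∀ n → N ℕ.≤ n → seq x n + ε ≤ seq y n))

_≤ℝ_ : ℝ → ℝ → Set
x ≤ℝ y = ∀ ε → 0ℚ < ε → ∃[ N ] (∀ n → N ℕ.≤ n → seq x n ≤ seq y n + ε)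

-- IsFloor x m says m = ⌊ x ⌋.  It is a relation because no floor function
-- ℝ → ℤ is definable constructively.
IsFloor : ℝ → ℤ → Set
IsFloor x m = fromℤ m ≤ℝ x × x <ℝ fromℤ m +ℝ 1ℝ

{-# OPTIONS --safe #-}

-- If x = ⌊τk⌋ and y = ⌊τl⌋ then x ≤ τk and τl < y + 1, so x + τl < τk + y + 1.
-- When k = l this gives x ≤ y, and y ≤ x by symmetry, so distinct values have
-- distinct indices.  When k < l, τ ≥ 0 gives τ ≤ τ(l − k) < 1 + y − x ≤ 1 + |x − y|.

module Submission where

open import Defs
open import Data.Integer.Base using (ℤ; +_; ∣_∣; _-_)
open import Data.List.Base using (List)
open import Data.List.Membership.Propositional using (_∈_)
open import Data.List.Relation.Unary.All using (All)
open import Data.Product using (∃-syntax)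
open import Relation.Binary.PropositionalEquality using (_≢_)

import Data.Integer.Base as ℤ
import Data.Integer.Properties as ℤₚ
import Data.List.Relation.Unary.All as All
import Data.Nat.Base as ℕ
import Data.Nat.Properties as ℕₚ
import Data.Rational.Unnormalised.Base as ℚᵘ
import Data.Rational.Unnormalised.Properties as ℚᵘₚ
open import Data.Empty using (⊥-elim)
open import Data.Product using (_,_)
open import Data.Rational.Base
  using (ℚ; 0ℚ; 1ℚ; ½; _+_; _*_; -_; _/_; _≤_; _<_; toℚᵘ; nonNegative)
open import Data.Rational.Properties
open import Data.Rational.Solver using (module +-*-Solver)
open import Relation.Binary.Definitions using (tri<; tri≈; tri>)
open import Relation.Binary.PropositionalEquality
  using (_≡_; refl; sym; trans; cong; subst; subst₂)
open import Relation.Nullary using (¬_)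
open +-*-Solver using (solve; _:=_; _:+_; _:*_; :-_; con)

+-cancelˡ-≤ : ∀ p {q r} → p + q ≤ p + r → q ≤ r
+-cancelˡ-≤ p {q} {r} p+q≤p+r =
  subst₂ _≤_ (strip q) (strip r) (+-monoʳ-≤ (- p) p+q≤p+r)
  where
  strip : ∀ s → - p + (p + s) ≡ s
  strip s = solve 2 (λ p s → :- p :+ (p :+ s) := s) refl p s

-- For variable `i` the normalised fraction `i / 1` is stuck on a gcd, so the comparison is made
-- between unnormalised fractions with denominator 1.
/1-mono-≤ : ∀ {i j} → i ℤ.≤ j → i / 1 ≤ j / 1
/1-mono-≤ {i} {j} i≤j = toℚᵘ-cancel-≤
  (ℚᵘₚ.≤-respˡ-≃ (ℚᵘₚ.≃-sym (toℚᵘ-fromℚᵘ (ℚᵘ.mkℚᵘ i 0)))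
  (ℚᵘₚ.≤-respʳ-≃ (ℚᵘₚ.≃-sym (toℚᵘ-fromℚᵘ (ℚᵘ.mkℚᵘ j 0)))
  (ℚᵘ.*≤* (ℤₚ.*-monoʳ-≤-nonNeg (+ 1) i≤j))))

/1-homo-+ : ∀ i j → (i ℤ.+ j) / 1 ≡ i / 1 + j / 1
/1-homo-+ i j = toℚᵘ-injective (begin
  toℚᵘ ((i ℤ.+ j) / 1)                ≈⟨ toℚᵘ-fromℚᵘ (ℚᵘ.mkℚᵘ (i ℤ.+ j) 0) ⟩
  ℚᵘ.mkℚᵘ (i ℤ.+ j) 0                 ≈⟨ ℚᵘ.*≡* (cong (ℤ._* + 1) (sym i1+j1)) ⟩
  ℚᵘ.mkℚᵘ i 0 ℚᵘ.+ ℚᵘ.mkℚᵘ j 0        ≈⟨ ℚᵘₚ.+-cong (toℚᵘ-fromℚᵘ (ℚᵘ.mkℚᵘ i 0)) (toℚᵘ-fromℚᵘ (ℚᵘ.mkℚᵘ j 0)) ⟨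
  toℚᵘ (i / 1) ℚᵘ.+ toℚᵘ (j / 1)      ≈⟨ toℚᵘ-homo-+ (i / 1) (j / 1) ⟨
  toℚᵘ (i / 1 + j / 1)                ∎)
  where
  open ℚᵘₚ.≃-Reasoning
  i1+j1 : i ℤ.* + 1 ℤ.+ j ℤ.* + 1 ≡ i ℤ.+ j
  i1+j1 rewrite ℤₚ.*-identityʳ i | ℤₚ.*-identityʳ j = refl

i≤+∣i∣ : ∀ i → i ℤ.≤ + ∣ i ∣
i≤+∣i∣ (+ n)      = ℤₚ.≤-refl
i≤+∣i∣ ℤ.-[1+ n ] = ℤ.-≤+

-- Holds for either order of `i` and `j`, so the floors themselves never have to be compared.
j≤i+∣i-j∣ : ∀ i j → j ℤ.≤ i ℤ.+ + ∣ i - j ∣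
j≤i+∣i-j∣ i j = subst₂ ℤ._≤_ i+[j-i]≡j
  (cong (λ d → i ℤ.+ + d) (ℤₚ.∣i-j∣≡∣j-i∣ j i))
  (ℤₚ.+-monoʳ-≤ i (i≤+∣i∣ (j - i)))
  where
  i+[j-i]≡j : i ℤ.+ (j - i) ≡ j
  i+[j-i]≡j rewrite ℤₚ.+-comm i (j - i) | ℤₚ.+-assoc j (ℤ.- i) i
                  | ℤₚ.+-inverseˡ i = ℤₚ.+-identityʳ j

/1-subadditive : ∀ i j k → k ℤ.≤ i ℤ.+ j → k / 1 ≤ i / 1 + j / 1
/1-subadditive i j k k≤i+j =
  subst (k / 1 ≤_) (/1-homo-+ i j) (/1-mono-≤ {k} {i ℤ.+ j} k≤i+j)

-- The strict inequality has a gap `ε`. Half of it absorbs the error allowed by the weak inequality,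
-- and the other half remains as the gap of the sum.
≤ℝ-<ℝ-+ : ∀ {a b c d} → a ≤ℝ b → c <ℝ d → a +ℝ c <ℝ b +ℝ d
≤ℝ-<ℝ-+ {a} {b} {c} {d} a≤b (ε , 0<ε , N , c+ε≤d) =
  let M , a≤b+½ε = a≤b (½ * ε) 0<½ε in
  ½ * ε , 0<½ε , M ℕ.⊔ N , λ n M⊔N≤n → gap n
    (a≤b+½ε n (ℕₚ.m⊔n≤o⇒m≤o M N M⊔N≤n)) (c+ε≤d n (ℕₚ.m⊔n≤o⇒n≤o M N M⊔N≤n))
  where
  0<½ε : 0ℚ < ½ * ε
  0<½ε = subst (_< ½ * ε) (*-zeroʳ ½) (*-monoʳ-<-pos ½ 0<ε)
  gap : ∀ n → seq a n ≤ seq b n + ½ * ε → seq c n + ε ≤ seq d n →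
        (seq a n + seq c n) + ½ * ε ≤ seq b n + seq d n
  gap n a≤b+h c+ε≤d = +-cancelˡ-≤ (½ * ε) (subst₂ _≤_
    (solve 3 (λ a c e → a :+ (c :+ e) :=
                        con ½ :* e :+ ((a :+ c) :+ con ½ :* e)) refl
             (seq a n) (seq c n) ε)
    (solve 3 (λ b d h → (b :+ h) :+ d := h :+ (b :+ d)) refl
             (seq b n) (seq d n) (½ * ε))
    (+-mono-≤ a≤b+h c+ε≤d))

-- The common source of both cases: `a = b` leads to uniqueness of the floor, two multiples of `τ`
-- to the bound on `τ`.
floor-<ℝ : ∀ {a b m n} → IsFloor a m → IsFloor b n →
           fromℤ m +ℝ b <ℝ a +ℝ (fromℤ n +ℝ 1ℝ)
floor-<ℝ {a} {b} {m} {n} (m≤a , _) (_ , b<n+1) =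
  ≤ℝ-<ℝ-+ {fromℤ m} {a} {b} {fromℤ n +ℝ 1ℝ} m≤a b<n+1

/1-suc : ∀ i → ℤ.suc i / 1 ≡ 1ℚ + i / 1
/1-suc i = trans (/1-homo-+ (+ 1) i) (cong (_+ i / 1) 1/1≡1)
  where
  1/1≡1 : + 1 / 1 ≡ 1ℚ
  1/1≡1 = refl

-- Discreteness of the integers: cancelling `s` leaves `m + ε ≤ n + 1`, whereas `n < m` would give
-- `n + 1 ≤ m`.
gap⇒≤ : ∀ m n s ε → 0ℚ < ε → (m / 1 + s) + ε ≤ s + (n / 1 + 1ℚ) → m ℤ.≤ n
gap⇒≤ m n s ε 0<ε gap = ℤₚ.≮⇒≥ n≮m
  where
  open ≤-Reasoning
  m+ε≤n+1 : m / 1 + ε ≤ n / 1 + 1ℚ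
  m+ε≤n+1 = +-cancelˡ-≤ s (subst (_≤ s + (n / 1 + 1ℚ))
    (solve 3 (λ m s e → (m :+ s) :+ e := s :+ (m :+ e)) refl (m / 1) s ε) gap)
  n≮m : ¬ (n ℤ.< m)
  n≮m n<m = <-irrefl refl (begin-strict
    m / 1             ≡⟨ +-identityʳ (m / 1) ⟨
    m / 1 + 0ℚ        <⟨ +-monoʳ-< (m / 1) 0<ε ⟩
    m / 1 + ε         ≤⟨ m+ε≤n+1 ⟩
    n / 1 + 1ℚ        ≡⟨ +-comm (n / 1) 1ℚ ⟩
    1ℚ + n / 1        ≡⟨ /1-suc n ⟨
    ℤ.suc n / 1       ≤⟨ /1-mono-≤ (ℤₚ.i<j⇒suc[i]≤j n<m) ⟩
    m / 1             ∎)

floor-≤ : ∀ {a m n} → IsFloor a m → IsFloor a n → m ℤ.≤ n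
floor-≤ {a} {m} {n} fm fn =
  let ε , 0<ε , N , gap = floor-<ℝ {a} {a} {m} {n} fm fn
  -- A single term of the sequence suffices, since `m` and `n` do not vary with the index.
  in gap⇒≤ m n (seq a N) ε 0<ε (gap N ℕₚ.≤-refl)

floor-unique : ∀ {a m n} → IsFloor a m → IsFloor a n → m ≡ n
floor-unique {a} {m} {n} fm fn =
  ℤₚ.≤-antisym (floor-≤ {a} {m} {n} fm fn) (floor-≤ {a} {n} {m} fn fm)

t+ti≤tj : ∀ t i j → 0ℚ ≤ t → ℤ.suc i ℤ.≤ j → t + t * (i / 1) ≤ t * (j / 1)
t+ti≤tj t i j 0≤t 1+i≤j = begin
  t + t * (i / 1)     ≡⟨ solve 2 (λ t i → t :+ t :* i := t :* (con 1ℚ :+ i))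
                               refl t (i / 1) ⟩
  t * (1ℚ + i / 1)    ≡⟨ cong (t *_) (/1-suc i) ⟨
  t * (ℤ.suc i / 1)   ≤⟨ *-monoˡ-≤-nonNeg t {{nonNegative 0≤t}} (/1-mono-≤ 1+i≤j) ⟩
  t * (j / 1)         ∎
  where open ≤-Reasoning

-- The casts i / 1 are kept abstract: on non-negative integers they unfold to a
-- gcd computation, which makes the comparison of such terms very slow.
gap-bound : ∀ t ε {X Y D κ ℓ} →
  t + t * κ ≤ t * ℓ → Y ≤ X + D →
  (X + t * ℓ) + ε ≤ t * κ + (Y + 1ℚ) → t + ε ≤ 1ℚ + D
gap-bound t ε {X} {Y} {D} {κ} {ℓ} t+tκ≤tℓ Y≤X+D gap = +-cancelˡ-≤ (X + t * κ) (begin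
  (X + t * κ) + (t + ε)
    ≡⟨ solve 4 (λ X p t e → (X :+ p) :+ (t :+ e) := (X :+ (t :+ p)) :+ e)
             refl X (t * κ) t ε ⟩
  (X + (t + t * κ)) + ε    ≤⟨ +-monoˡ-≤ ε (+-monoʳ-≤ X t+tκ≤tℓ) ⟩
  (X + t * ℓ) + ε          ≤⟨ gap ⟩
  t * κ + (Y + 1ℚ)         ≤⟨ +-monoʳ-≤ (t * κ) (+-monoˡ-≤ 1ℚ Y≤X+D) ⟩
  t * κ + ((X + D) + 1ℚ)
    ≡⟨ solve 3 (λ X p D → p :+ ((X :+ D) :+ con 1ℚ) := (X :+ p) :+ (con 1ℚ :+ D))
             refl X (t * κ) D ⟩
  (X + t * κ) + (1ℚ + D)   ∎)
  where open ≤-Reasoning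

floor-multiples-apart : ∀ τ → 1ℝ ≤ℝ τ → ∀ {k l x y} → k ℕ.< l →
  IsFloor (τ *ℝ fromℕ k) x → IsFloor (τ *ℝ fromℕ l) y →
  τ <ℝ 1ℝ +ℝ fromℤ (+ ∣ x - y ∣)
floor-multiples-apart τ 1≤τ {k} {l} {x} {y} k<l fx fy =
  let ε , 0<ε , M , gap = floor-<ℝ {τ *ℝ fromℕ k} {τ *ℝ fromℕ l} {x} {y} fx fy
      -- Tolerance 1 turns `1 ≤ τ` into `0 ≤ seq τ n` for all `n` from `N` on.
      N , 1≤τ+1 = 1≤τ 1ℚ (positive⁻¹ 1ℚ)
  -- The gap `ε` survives unchanged, because the remaining steps are termwise weak inequalities.
  in ε , 0<ε , M ℕ.⊔ N , λ n M⊔N≤n →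
    gap-bound (seq τ n) ε {x / 1} {y / 1} {+ ∣ x - y ∣ / 1} {+ k / 1} {+ l / 1}
      (t+ti≤tj (seq τ n) (+ k) (+ l)
        (0≤t (seq τ n) (1≤τ+1 n (ℕₚ.m⊔n≤o⇒n≤o M N M⊔N≤n))) (ℤ.+≤+ k<l))
      (/1-subadditive x (+ ∣ x - y ∣) y (j≤i+∣i-j∣ x y))
      (gap n (ℕₚ.m⊔n≤o⇒m≤o M N M⊔N≤n))
  where
  0≤t : ∀ t → 1ℚ ≤ t + 1ℚ → 0ℚ ≤ t
  0≤t t 1≤t+1 = +-cancelˡ-≤ 1ℚ (subst (1ℚ ≤_) (+-comm t 1ℚ) 1≤t+1)

proposition7 : ∀ (τ : ℝ) → 1ℝ ≤ℝ τ →
    ∀ (S : List ℤ) → All (λ m → ∃[ k ] IsFloor (τ *ℝ fromℕ k) m) S →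
    ∀ (x y : ℤ) → x ∈ S → y ∈ S → x ≢ y →
    τ <ℝ 1ℝ +ℝ fromℤ (+ ∣ x - y ∣)
proposition7 τ 1≤τ S floors x y x∈S y∈S x≢y
  with All.lookup floors x∈S | All.lookup floors y∈S
-- The split is on the indices, whose order is what bounds `τ`, and not on `x` and `y`.
... | k , fx | l , fy with ℕₚ.<-cmp k l
...   | tri< k<l _ _  = floor-multiples-apart τ 1≤τ {k} {l} {x} {y} k<l fx fy
...   | tri≈ _ refl _ = ⊥-elim (x≢y (floor-unique {τ *ℝ fromℕ k} {x} {y} fx fy))
-- The roles of `x` and `y` are exchanged, and symmetry of the distance restores the stated form.
...   | tri> _ _ l<k  = subst (λ d → τ <ℝ 1ℝ +ℝ fromℤ (+ d))
          (ℤₚ.∣i-j∣≡∣j-i∣ y x) (floor-multiples-apart τ 1≤τ {l} {k} {y} {x} l<k fy fx)
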